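{- Let $p$ and $q$ be distinct primes satisfying $p \equiv 33 \pmod{40}$ and $q \equiv 7 \pmod{40}$. Then the rank of the elliptic curve $E_{pq}: y^2 = x^3 - 5pqx$ over $\mathbb{Q}$ is zero.
   Context: For an elliptic curve $E$ over a number field $\mathbb{K}$, the rank of $E$ over $\mathbb{K}$ is the integer $r \ge 0$ such that $E(\mathbb{K}) \cong \mathbb{Z}^r \oplus E(\mathbb{K})_{tors}$ (Mordell-Weil). -}

module Defs where

open import Algebra.Bundles using (AbelianGroup; Group; RawGroup)
import Algebra.Construct.DirectProduct as DirectProduct
import Algebra.Construct.Pointwise as Pointwise
import Algebra.Definitions.RawMonoid as RawMonoidDefinitions
import Algebra.Morphism.Structures as Morphisms
open import Algebra.Properties.Group using (x∙y⁻¹≈ε⇒x≈y; inverseˡ-unique)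
open import Data.Fin.Base using (Fin)
open import Data.Integer.Base using (ℤ; +_)
import Data.Integer.Properties as ℤ
open import Data.Nat.Base as ℕ using (ℕ)
import Data.Nat.Properties as ℕ
open import Data.Nat.Primality using (Prime; prime⇒nonZero)
open import Data.Product.Base using (_×_; _,_; ∃)
open import Data.Rational.Base
  using (ℚ; 0ℚ; 1ℚ; _+_; _*_; _-_; -_; _÷_; 1/_; _/_; NonZero; ≢-nonZero;
         Positive)
open import Data.Rational.Properties
  using (_≟_; +-0-group; *-inverseˡ; *-assoc; *-identityˡ;
         *-identityʳ; *-zeroʳ; normalize-pos)
open import Data.Rational.Solver using (module +-*-Solver)
open import Function.Bundles using (_⇔_)
open import Level using (Level; _⊔_)
open import Relation.Binary.PropositionalEquality
open import Relation.Nullary using (yes; no; contradiction; recompute)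

private
  variable
    c ℓ : Level

2ℚ 3ℚ 4ℚ 27ℚ : ℚ
2ℚ  = + 2 / 1
3ℚ  = + 3 / 1
4ℚ  = + 4 / 1
27ℚ = + 27 / 1

------------------------------------------------------------------------
-- Rank of an abelian group

-- Stated for raw groups: the group laws are not needed to say what torsion and
-- rank are, and the point group below is given by its operations alone.

module _ (G : RawGroup c ℓ) where
  open RawGroup G
  open RawMonoidDefinitions rawMonoid using () renaming (_×_ to _·_)

  IsTorsion : Carrier → Set ℓ
  IsTorsion g = ∃ λ n → n ℕ.> 0 × (n · g) ≈ ε

ℤ^ : ℕ → RawGroup _ _
ℤ^ r = AbelianGroup.rawGroup (Pointwise.abelianGroup (Fin r) ℤ.+-0-abelianGroup)

-- An isomorphism G ≅ ℤʳ ⊕ G_tors, with ℤʳ ⊕ G_tors regarded as the subgroup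
-- of ℤʳ ⊕ G consisting of the pairs with torsion second component: an
-- injective homomorphism G → ℤʳ ⊕ G with exactly that image.
record HasRank (G : RawGroup c ℓ) (r : ℕ) : Set (c ⊔ ℓ) where
  ℤʳ⊕G : RawGroup _ _
  ℤʳ⊕G = DirectProduct.rawGroup (ℤ^ r) G

  open RawGroup G using (Carrier)
  open RawGroup ℤʳ⊕G using () renaming (_≈_ to _≈⊕_)
  open Morphisms.GroupMorphisms G ℤʳ⊕G using (IsGroupMonomorphism)

  field
    to                  : Carrier → RawGroup.Carrier ℤʳ⊕G
    isGroupMonomorphism : IsGroupMonomorphism to
    image               : ∀ v t → IsTorsion G t ⇔ (∃ λ g → to g ≈⊕ (v , t))

------------------------------------------------------------------------
-- Elliptic curves over ℚ

-- y² = x³ + ax + b; in characteristic 0 every elliptic curve has such a model.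
record EllipticCurve : Set where
  field
    a b         : ℚ
    nonsingular : 4ℚ * (a * a * a) + 27ℚ * (b * b) ≢ 0ℚ

xy≡0⇒y≡0 : ∀ {x y} → x ≢ 0ℚ → x * y ≡ 0ℚ → y ≡ 0ℚ
xy≡0⇒y≡0 {x} {y} x≢0 xy≡0 = begin
  y              ≡⟨ *-identityˡ y ⟨
  1ℚ * y         ≡⟨ cong (_* y) (*-inverseˡ x) ⟨
  1/ x * x * y   ≡⟨ *-assoc (1/ x) x y ⟩
  1/ x * (x * y) ≡⟨ cong (1/ x *_) xy≡0 ⟩
  1/ x * 0ℚ      ≡⟨ *-zeroʳ (1/ x) ⟩
  0ℚ             ∎
  where
  open ≡-Reasoning
  instance _ = ≢-nonZero x≢0

÷-*-cancel : ∀ x y .{{_ : NonZero y}} → (x ÷ y) * y ≡ x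
÷-*-cancel x y = begin
  x * 1/ y * y   ≡⟨ *-assoc x (1/ y) y ⟩
  x * (1/ y * y) ≡⟨ cong (x *_) (*-inverseˡ y) ⟩
  x * 1ℚ         ≡⟨ *-identityʳ x ⟩
  x              ∎
  where open ≡-Reasoning

x-y≡0⇒x≡y : ∀ {x y} → x - y ≡ 0ℚ → x ≡ y
x-y≡0⇒x≡y {x} {y} = x∙y⁻¹≈ε⇒x≈y +-0-group x y

x≡y⇒x-y≡0 : ∀ {x y} → x ≡ y → x - y ≡ 0ℚ
x≡y⇒x-y≡0 {x} refl = Group.inverseʳ +-0-group x

module _ (E : EllipticCurve) where
  open EllipticCurve E

  OnCurve : ℚ → ℚ → Set
  OnCurve x y = y * y ≡ x * x * x + a * x + b

  -- The curve equation is an irrelevant argument, so that _≡_ on points is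
  -- equality of coordinates.
  data Point : Set where
    O      : Point
    affine : (x y : ℚ) → .(OnCurve x y) → Point

  open +-*-Solver

  -- With f(x) = x³ + ax + b and ℓ(x) = l(x - x₁) + y₁, where y₁² = f(x₁),
  -- f - ℓ² = (x - x₁) h.  Here residual x is h(x).
  residual : (x₁ y₁ l x : ℚ) → ℚ
  residual x₁ y₁ l x =
    x * x + x * x₁ + x₁ * x₁ + a - l * l * (x - x₁) - 2ℚ * (l * y₁)

  thirdX : (x₁ x₂ l : ℚ) → ℚ
  thirdX x₁ x₂ l = l * l - x₁ - x₂

  thirdY : (x₁ y₁ x₂ l : ℚ) → ℚ
  thirdY x₁ y₁ x₂ l = l * (x₁ - thirdX x₁ x₂ l) - y₁

  closed : ∀ x₁ y₁ x₂ l → OnCurve x₁ y₁ → residual x₁ y₁ l x₂ ≡ 0ℚ →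
           OnCurve (thirdX x₁ x₂ l) (thirdY x₁ y₁ x₂ l)
  closed x₁ y₁ x₂ l p₁ h≡0 = x-y≡0⇒x≡y (begin
    y₃ * y₃ - (x₃ * x₃ * x₃ + a * x₃ + b)
      ≡⟨ solve 6 (λ A B X₁ Y₁ X₂ L →
           let X₃ = L :* L :- X₁ :- X₂
               Y₃ = L :* (X₁ :- X₃) :- Y₁
               H  = X₂ :* X₂ :+ X₂ :* X₁ :+ X₁ :* X₁ :+ A :- L :* L :* (X₂ :- X₁) :- con 2ℚ :* (L :* Y₁)
           in Y₃ :* Y₃ :- (X₃ :* X₃ :* X₃ :+ A :* X₃ :+ B)
              := (Y₁ :* Y₁ :- (X₁ :* X₁ :* X₁ :+ A :* X₁ :+ B)) :+ (X₁ :- X₃) :* H)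
           refl a b x₁ y₁ x₂ l ⟩
    (y₁ * y₁ - (x₁ * x₁ * x₁ + a * x₁ + b)) + (x₁ - x₃) * residual x₁ y₁ l x₂
      ≡⟨ cong₂ (λ u v → u + (x₁ - x₃) * v) (x≡y⇒x-y≡0 p₁) h≡0 ⟩
    0ℚ + (x₁ - x₃) * 0ℚ
      ≡⟨ cong (λ v → 0ℚ + v) (*-zeroʳ (x₁ - x₃)) ⟩
    0ℚ ∎)
    where
    open ≡-Reasoning
    x₃ = thirdX x₁ x₂ l
    y₃ = thirdY x₁ y₁ x₂ l

  chord : ∀ x₁ y₁ x₂ y₂ l → OnCurve x₁ y₁ → OnCurve x₂ y₂ → x₂ - x₁ ≢ 0ℚ →
          l * (x₂ - x₁) ≡ y₂ - y₁ → residual x₁ y₁ l x₂ ≡ 0ℚ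
  chord x₁ y₁ x₂ y₂ l p₁ p₂ x₂≢x₁ eq = xy≡0⇒y≡0 x₂≢x₁ (begin
    (x₂ - x₁) * residual x₁ y₁ l x₂
      ≡⟨ solve 7 (λ A B X₁ Y₁ X₂ Y₂ L →
           let H = X₂ :* X₂ :+ X₂ :* X₁ :+ X₁ :* X₁ :+ A :- L :* L :* (X₂ :- X₁) :- con 2ℚ :* (L :* Y₁)
               D = L :* (X₂ :- X₁)
           in (X₂ :- X₁) :* H
              := (Y₁ :* Y₁ :- (X₁ :* X₁ :* X₁ :+ A :* X₁ :+ B))
                 :- (Y₂ :* Y₂ :- (X₂ :* X₂ :* X₂ :+ A :* X₂ :+ B))
                 :+ (Y₂ :- Y₁ :- D) :* (Y₂ :+ Y₁ :+ D))
           refl a b x₁ y₁ x₂ y₂ l ⟩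
    (y₁ * y₁ - (x₁ * x₁ * x₁ + a * x₁ + b))
      - (y₂ * y₂ - (x₂ * x₂ * x₂ + a * x₂ + b))
      + (y₂ - y₁ - d) * (y₂ + y₁ + d)
      ≡⟨ cong₂ (λ u v → u + v * (y₂ + y₁ + d))
           (cong₂ _-_ (x≡y⇒x-y≡0 p₁) (x≡y⇒x-y≡0 p₂)) (x≡y⇒x-y≡0 (sym eq)) ⟩
    0ℚ - 0ℚ + 0ℚ * (y₂ + y₁ + d)
      ≡⟨ solve 1 (λ z → con 0ℚ :- con 0ℚ :+ con 0ℚ :* z := con 0ℚ) refl (y₂ + y₁ + d) ⟩
    0ℚ ∎)
    where
    open ≡-Reasoning
    d = l * (x₂ - x₁)

  tangent : ∀ x₁ y₁ x₂ l → x₁ ≡ x₂ → l * (2ℚ * y₁) ≡ 3ℚ * (x₁ * x₁) + a →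
            residual x₁ y₁ l x₂ ≡ 0ℚ
  tangent x₁ y₁ _ l refl eq = begin
    residual x₁ y₁ l x₁
      ≡⟨ solve 4 (λ A X Y L →
           X :* X :+ X :* X :+ X :* X :+ A :- L :* L :* (X :- X) :- con 2ℚ :* (L :* Y)
           := con 3ℚ :* (X :* X) :+ A :- L :* (con 2ℚ :* Y))
           refl a x₁ y₁ l ⟩
    3ℚ * (x₁ * x₁) + a - l * (2ℚ * y₁)
      ≡⟨ x≡y⇒x-y≡0 (sym eq) ⟩
    0ℚ ∎
    where open ≡-Reasoning

  onCurve-recompute : ∀ x y → .(OnCurve x y) → OnCurve x y
  onCurve-recompute _ _ p = recompute (_ ≟ _) p

  2y≢0 : ∀ x₁ y₁ x₂ y₂ → .(OnCurve x₁ y₁) → .(OnCurve x₂ y₂) → x₁ ≡ x₂ → y₁ ≢ - y₂ →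
         2ℚ * y₁ ≢ 0ℚ
  2y≢0 x₁ y₁ _ y₂ p₁ p₂ refl y₁≢-y₂ 2y₁≡0 = y₁+y₂≢0 (begin
    y₁ + y₂             ≡⟨ cong (λ v → y₁ + v) (x-y≡0⇒x≡y y₂-y₁≡0) ⟩
    y₁ + y₁             ≡⟨ solve 1 (λ y → y :+ y := con 2ℚ :* y) refl y₁ ⟩
    2ℚ * y₁             ≡⟨ 2y₁≡0 ⟩
    0ℚ                  ∎)
    where
    open ≡-Reasoning
    y₁+y₂≢0 : y₁ + y₂ ≢ 0ℚ
    y₁+y₂≢0 eq = y₁≢-y₂ (inverseˡ-unique +-0-group y₁ y₂ eq)

    y₂-y₁≡0 : y₂ - y₁ ≡ 0ℚ
    y₂-y₁≡0 = xy≡0⇒y≡0 y₁+y₂≢0 (begin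
      (y₁ + y₂) * (y₂ - y₁)
        ≡⟨ solve 2 (λ u v → (u :+ v) :* (v :- u) := v :* v :- u :* u) refl y₁ y₂ ⟩
      y₂ * y₂ - y₁ * y₁   ≡⟨ x≡y⇒x-y≡0
            (trans (onCurve-recompute x₁ y₂ p₂) (sym (onCurve-recompute x₁ y₁ p₁))) ⟩
      0ℚ                  ∎)

  negate : ∀ x y → OnCurve x y → OnCurve x (- y)
  negate x y p = trans (solve 1 (λ v → (:- v) :* (:- v) := v :* v) refl y) p

  infixl 6 _⊞_

  _⊞_ : Point → Point → Point
  O              ⊞ Q              = Q
  P              ⊞ O              = P
  affine x₁ y₁ p ⊞ affine x₂ y₂ q with x₁ ≟ x₂ | y₁ ≟ - y₂
  ... | no x₁≢x₂ | _ = affine (thirdX x₁ x₂ l) (thirdY x₁ y₁ x₂ l)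
    (closed x₁ y₁ x₂ l p
      (chord x₁ y₁ x₂ y₂ l p q dx≢0 (÷-*-cancel (y₂ - y₁) (x₂ - x₁))))
    where
    dx≢0 : x₂ - x₁ ≢ 0ℚ
    dx≢0 eq = x₁≢x₂ (sym (x-y≡0⇒x≡y eq))
    instance _ = ≢-nonZero dx≢0
    l : ℚ
    l = (y₂ - y₁) ÷ (x₂ - x₁)
  ... | yes x₁≡x₂ | yes _ = O
  ... | yes x₁≡x₂ | no y₁≢-y₂ = affine (thirdX x₁ x₂ l) (thirdY x₁ y₁ x₂ l)
    (closed x₁ y₁ x₂ l p
      (tangent x₁ y₁ x₂ l x₁≡x₂ (÷-*-cancel (3ℚ * (x₁ * x₁) + a) (2ℚ * y₁))))
    where
    instance _ = ≢-nonZero (2y≢0 x₁ y₁ x₂ y₂ p q x₁≡x₂ y₁≢-y₂)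
    l : ℚ
    l = (3ℚ * (x₁ * x₁) + a) ÷ (2ℚ * y₁)

  ⊟_ : Point → Point
  ⊟ O            = O
  ⊟ affine x y p = affine x (- y) (negate x y p)

  pointGroup : RawGroup _ _
  pointGroup = record
    { Carrier = Point
    ; _≈_     = _≡_
    ; _∙_     = _⊞_
    ; ε       = O
    ; _⁻¹     = ⊟_
    }

------------------------------------------------------------------------
-- The curve y² = x³ - 5pqx

curve : ∀ p q → Prime p → Prime q → EllipticCurve
curve p q pp qp = record
  { a = - N
  ; b = 0ℚ
  ; nonsingular = λ eq →
      N≢0 (xy≡0⇒y≡0 N≢0 (xy≡0⇒y≡0 N≢0 (xy≡0⇒y≡0 {x = - 4ℚ} (λ ()) (trans (lemma N) eq))))
  }
  where
  N : ℚ
  N = + (5 ℕ.* p ℕ.* q) / 1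

  N≢0 : N ≢ 0ℚ
  N≢0 eq = contradiction (subst Positive eq N>0) (λ ())
    where
    N>0 : Positive N
    N>0 = normalize-pos (5 ℕ.* p ℕ.* q) 1
      {{_}} {{ℕ.m*n≢0 (5 ℕ.* p) q {{ℕ.m*n≢0 5 p {{_}} {{prime⇒nonZero pp}}}} {{prime⇒nonZero qp}}}}

  lemma : ∀ n → - 4ℚ * (n * (n * n)) ≡ 4ℚ * (- n * - n * - n) + 27ℚ * (0ℚ * 0ℚ)
  lemma = solve 1 (λ n →
    con (- 4ℚ) :* (n :* (n :* n))
    := con 4ℚ :* (:- n :* :- n :* :- n) :+ con 27ℚ :* (con 0ℚ :* con 0ℚ)) refl
    where open +-*-Solver

{-# OPTIONS --safe #-}

-- Put D = 5pq.  If P = (x, y) is a rational point with y ≠ 0, then x(2P) = w² with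
-- w⁴ - D a square, so that n² + D e⁴ = m⁴ for some coprime m, e with e > 0.  Modulo 8,
-- e is even and n, m are odd; factoring (m² - n)(m² + n) = D e⁴ gives coprime u, v with
-- 4u + v = m² and uv = D (e/2)⁴.  Of the factorisations u = d₁ r⁴, v = d₂ s⁴ with
-- d₁ d₂ = D, congruences modulo 4, 5 and q (5 is not a square modulo q) leave only
-- d₂ = 1, so s⁴ + 4D r⁴ = m².  Factoring (m - s²)(m + s²) in the same way gives
-- s² + D k⁴ = l⁴ with 0 < k < e, and infinite descent applies.  Hence every rational
-- point is O or has y = 0, and so is torsion.
module Submission where

open import Defs
open import Data.Nat using (ℕ; _%_)
open import Data.Nat.Primality using (Prime)
open import Relation.Binary.PropositionalEquality using (_≡_; _≢_)

open import Data.Bool.Base using (Bool; true; false; not; if_then_else_)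
open import Data.Integer.Base as ℤ using (+_; -[1+_]; ∣_∣)
import Data.Integer.Properties as ℤ
import Data.Integer.Solver as ℤSolver
open import Data.Nat hiding (ℕ; _%_; parity)
open import Data.Nat.Coprimality as Coprimality using (Coprime; coprime-divisor)
open import Data.Nat.DivMod
  using (m*[n/m]≡n; m%n%n≡m%n; m%n<n; m<n⇒m%n≡m; m≡m%n+[m/n]*n; %-distribˡ-+;
         %-distribˡ-*; [m+kn]%n≡m%n; /-monoˡ-≤; m∣n⇒o%n%m≡o%m)
open import Data.Nat.Divisibility
open import Data.Nat.GCD using (module Bézout; gcd; gcd[m,n]∣m; gcd[m,n]∣n; gcd[m,n]≢0)
open import Data.Nat.Induction using (<-rec)
open import Data.Nat.Primality hiding (Prime)
open import Data.Nat.Properties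
open import Data.Nat.Solver using (module +-*-Solver)
open import Data.Product.Base using (_×_; _,_; ∃; ∃₂; proj₂)
open import Data.Rational.Base as ℚ using (mkℚ; 0ℚ)
import Data.Rational.Properties as ℚ
open import Data.Rational.Unnormalised.Base as ℚᵘ using (mkℚᵘ)
import Data.Rational.Unnormalised.Properties as ℚᵘ
open import Data.Sum.Base using (_⊎_; inj₁; inj₂)
open import Function.Base using (_∘_)
open import Function.Bundles using (mk⇔)
open import Relation.Binary.PropositionalEquality hiding (_≡_; _≢_)
open import Relation.Nullary using (¬_; yes; no; contradiction; ¬?; _→-dec_; from-yes)

open +-*-Solver using (solve; con; _:=_; _:+_; _:*_; _:^_)
open ℤSolver.+-*-Solver using () renaming
  (solve to ℤ-solve; con to ⟨_⟩; _:=_ to _⊜_; _:+_ to _⊕_; _:-_ to _⊖_; _:*_ to _⊗_; :-_ to ⊝_)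

private
  variable
    a b c d k l m n u v : ℕ

-- Congruences

infix 4 _≈_[_]

-- A record instead of a bare equation between residues, so that `a`, `b` and `d` can be inferred
-- from a proof.
record _≈_[_] (a b d : ℕ) .{{_ : NonZero d}} : Set where
  constructor congruent
  field residues : a % d ≡ b % d

open _≈_[_]

module _ {d : ℕ} .{{_ : NonZero d}} where

  ≈-reflexive : a ≡ b → a ≈ b [ d ]
  ≈-reflexive refl = congruent refl

  ≈-refl : a ≈ a [ d ]
  ≈-refl = congruent refl

  ≈-sym : a ≈ b [ d ] → b ≈ a [ d ]
  ≈-sym (congruent p) = congruent (sym p)

  ≈-trans : a ≈ b [ d ] → b ≈ c [ d ] → a ≈ c [ d ]
  ≈-trans (congruent p) (congruent q) = congruent (trans p q)

  ≈-% : ∀ a → a ≈ a % d [ d ]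
  ≈-% a = congruent (sym (m%n%n≡m%n a d))

  +-cong : a ≈ b [ d ] → m ≈ n [ d ] → a + m ≈ b + n [ d ]
  +-cong {a} {b} {m} {n} (congruent p) (congruent q) = congruent (begin
    (a + m) % d           ≡⟨ %-distribˡ-+ a m d ⟩
    (a % d + m % d) % d   ≡⟨ cong₂ (λ x y → (x + y) % d) p q ⟩
    (b % d + n % d) % d   ≡⟨ %-distribˡ-+ b n d ⟨
    (b + n) % d           ∎)
    where open ≡-Reasoning

  *-cong : a ≈ b [ d ] → m ≈ n [ d ] → a * m ≈ b * n [ d ]
  *-cong {a} {b} {m} {n} (congruent p) (congruent q) = congruent (begin
    (a * m) % d             ≡⟨ %-distribˡ-* a m d ⟩
    (a % d * (m % d)) % d   ≡⟨ cong₂ (λ x y → (x * y) % d) p q ⟩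
    (b % d * (n % d)) % d   ≡⟨ %-distribˡ-* b n d ⟨
    (b * n) % d             ∎)
    where open ≡-Reasoning

  ^-cong : ∀ k → a ≈ b [ d ] → a ^ k ≈ b ^ k [ d ]
  ^-cong zero    p = ≈-refl
  ^-cong (suc k) p = *-cong p (^-cong k p)

  ≡+*⇒≈ : ∀ k → a ≡ b + k * d → a ≈ b [ d ]
  ≡+*⇒≈ {b = b} k refl = congruent ([m+kn]%n≡m%n b k d)

  ∣⇒≈0 : d ∣ a → a ≈ 0 [ d ]
  ∣⇒≈0 (divides k eq) = ≡+*⇒≈ k eq

  ≈0⇒∣ : a ≈ 0 [ d ] → d ∣ a
  ≈0⇒∣ (congruent p) = m%n≡0⇒n∣m _ d (trans p (m<n⇒m%n≡m (>-nonZero⁻¹ d)))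

  ≈⇒≡+* : b ≤ a → a ≈ b [ d ] → ∃ λ k → a ≡ b + k * d
  -- The witness is the difference of the quotients; `b≤a` keeps the truncated subtraction exact.
  ≈⇒≡+* {b} {a} b≤a (congruent p) = a / d ∸ b / d , (begin
    a                                        ≡⟨ m≡m%n+[m/n]*n a d ⟩
    a % d + a / d * d                        ≡⟨ cong₂ (λ x y → x + y * d) p
                                                  (sym (m+[n∸m]≡n (/-monoˡ-≤ d b≤a))) ⟩
    b % d + (b / d + (a / d ∸ b / d)) * d    ≡⟨ solve 4 (λ r x y d → r :+ (x :+ y) :* d
                                                               := r :+ x :* d :+ y :* d)
                                                  refl (b % d) (b / d) (a / d ∸ b / d) d ⟩
    b % d + b / d * d + (a / d ∸ b / d) * d  ≡⟨ cong (_+ (a / d ∸ b / d) * d) (m≡m%n+[m/n]*n b d) ⟨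
    b + (a / d ∸ b / d) * d                  ∎)
    where open ≡-Reasoning

%≡⇒≈ : ∀ {r} d o .{{_ : NonZero d}} .{{_ : NonZero o}} → d ∣ o → a % o ≡ r → a ≈ r [ d ]
%≡⇒≈ {a = a} d o d∣o refl = congruent (sym (m∣n⇒o%n%m≡o%m d o a d∣o))

-- The quadratic character of 5

5-prime : Prime 5
5-prime = from-yes (prime? 5)

2-prime : Prime 2
2-prime = from-yes (prime? 2)

prime∣^⇒∣ : Prime k → ∀ i → k ∣ n ^ i → k ∣ n
prime∣^⇒∣ {n = n} k-prime zero    k∣1 with refl ← ∣1⇒≡1 k∣1 = 1∣ n
prime∣^⇒∣ {n = n} k-prime (suc i) k∣nⁱ with euclidsLemma n (n ^ i) k-prime k∣nⁱ
... | inj₁ k∣n  = k∣n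
... | inj₂ k∣nⁱ = prime∣^⇒∣ k-prime i k∣nⁱ

private
  odd-factor₂ : ∀ {i} → i < 2 → ∀ {j} → j < 2 → (i * j) % 2 ≡ 1 → i ≡ 1
  odd-factor₂ = from-yes (allUpTo? (λ i → allUpTo? (λ j → (i * j) % 2 ≟ 1 →-dec i ≟ 1) 2) 2)

odd-factorˡ : ∀ m n → m * n ≈ 1 [ 2 ] → m ≈ 1 [ 2 ]
odd-factorˡ m n p = ≈-trans (≈-% m) (≈-reflexive (odd-factor₂ (m%n<n m 2) (m%n<n n 2)
  (residues (≈-trans (≈-sym (*-cong (≈-% m) (≈-% n))) p))))

odd-or-even : ∀ n → n ≈ 0 [ 2 ] ⊎ n ≈ 1 [ 2 ]
odd-or-even n with n % 2 in eq | m%n<n n 2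
... | 0           | _ = inj₁ (congruent eq)
... | 1           | _ = inj₂ (congruent eq)
... | suc (suc _) | s≤s (s≤s ())

private
  -- The classes with square 1 modulo 5 are the nonzero squares 1 and 4, which form a group under
  -- multiplication.
  square-quotient₅ : ∀ {a} → a < 5 → ∀ {k} → k < 5 → ∀ {m} → m < 5 →
    a ^ 2 % 5 ≡ (k * m) % 5 → k ^ 2 % 5 ≡ 1 → m ≢ 0 → m ^ 2 % 5 ≡ 1
  square-quotient₅ = from-yes (allUpTo? (λ a → allUpTo? (λ k → allUpTo? (λ m →
    a ^ 2 % 5 ≟ (k * m) % 5 →-dec k ^ 2 % 5 ≟ 1 →-dec ¬? (m ≟ 0) →-dec m ^ 2 % 5 ≟ 1) 5) 5) 5)

  -- The left side is 0, so `k * m` is -1 and the squares of `k` and `m` multiply to 1.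
  square-cofactor₅ : ∀ {a} → a < 5 → ∀ {k} → k < 5 → ∀ {m} → m < 5 →
    (5 * a ^ 2) % 5 ≡ (1 + k * m) % 5 → k ^ 2 % 5 ≡ 1 → m ^ 2 % 5 ≡ 1
  square-cofactor₅ = from-yes (allUpTo? (λ a → allUpTo? (λ k → allUpTo? (λ m →
    (5 * a ^ 2) % 5 ≟ (1 + k * m) % 5 →-dec k ^ 2 % 5 ≟ 1 →-dec m ^ 2 % 5 ≟ 1) 5) 5) 5)

odd⇒nonZero : n ≈ 1 [ 2 ] → NonZero n
odd⇒nonZero {zero}  (congruent ())
odd⇒nonZero {suc _} _ = _

-- With `t = m - r` this is `t² + r m = r² + t m`, an identity free of subtraction.
reflect² : ∀ {r m} .{{_ : NonZero m}} → r ≤ m → (m ∸ r) ^ 2 ≈ r ^ 2 [ m ]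
reflect² {r} {m} r≤m = ≈-trans (≈-sym (≡+*⇒≈ {a = t ^ 2 + r * m} r refl))
  (≡+*⇒≈ t (begin
    t ^ 2 + r * m         ≡⟨ cong (λ x → t ^ 2 + r * x) (m+[n∸m]≡n r≤m) ⟨
    t ^ 2 + r * (r + t)   ≡⟨ solve 2 (λ r t → t :^ 2 :+ r :* (r :+ t)
                                           := r :^ 2 :+ t :* (r :+ t)) refl r t ⟩
    r ^ 2 + t * (r + t)   ≡⟨ cong (λ x → r ^ 2 + t * x) (m+[n∸m]≡n r≤m) ⟩
    r ^ 2 + t * m         ∎))
  where
  open ≡-Reasoning
  t = m ∸ r

-- As `m` is odd, `a % m` and `m - a % m` have opposite parities, and their squares agree modulo
-- `m`.
even-representative : ∀ {m} .{{_ : NonZero m}} → m ≈ 1 [ 2 ] → ∀ a →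
  ∃ λ r → r ≤ m × r ≈ 0 [ 2 ] × r ^ 2 ≈ a ^ 2 [ m ]
even-representative {m} m-odd a with odd-or-even (a % m)
... | inj₁ even = a % m , <⇒≤ (m%n<n a m) , even , ^-cong 2 (≈-sym (≈-% a))
... | inj₂ odd  = t , m∸n≤m m (a % m) , t-even ,
                  ≈-trans (reflect² (<⇒≤ (m%n<n a m))) (^-cong 2 (≈-sym (≈-% a)))
  where
  t = m ∸ a % m
  t-even : t ≈ 0 [ 2 ]
  -- Modulo 2, `t` becomes `t + 2`, then `t + a % m + m = m + m`, then 0.
  t-even = ≈-trans (≈-sym (≡+*⇒≈ {a = t + 2} 1 refl))
    (≈-trans (+-cong {a = t} ≈-refl (+-cong (≈-sym odd) (≈-sym m-odd)))
    (≈-trans (≈-reflexive (trans (sym (+-assoc t (a % m) m))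
      (cong (_+ m) (m∸n+n≡m (<⇒≤ (m%n<n a m))))))
    (≈-trans (+-cong m-odd m-odd) (congruent refl))))

-- Gauss's induction: choose a even with a ≤ m; for a > 2, a² - 5 = k m with k odd
-- and k < m, so the claim for m follows from the claim for k (or for k / 5).
5-residue⇒±1 : ∀ m a → m ≈ 1 [ 2 ] → ¬ 5 ∣ m → .{{_ : NonZero m}} →
               a ^ 2 ≈ 5 [ m ] → m ^ 2 ≈ 1 [ 5 ]
5-residue⇒±1 = <-rec P step
  where
  P : ℕ → Set
  P m = ∀ a → m ≈ 1 [ 2 ] → ¬ 5 ∣ m → .{{_ : NonZero m}} →
        a ^ 2 ≈ 5 [ m ] → m ^ 2 ≈ 1 [ 5 ]

  even-step : ∀ m → (∀ {k} → k < m → P k) → ∀ a → a ≤ m → a ≈ 0 [ 2 ] → m ≈ 1 [ 2 ] →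
              ¬ 5 ∣ m → .{{_ : NonZero m}} → a ^ 2 ≈ 5 [ m ] → m ^ 2 ≈ 1 [ 5 ]
  -- The even `a` with `a² < 5` are 0 and 2, and each forces `m = 1`.
  even-step m rec 0 _ _ _ 5∤m a²≈5 with ≈⇒≡+* z≤n (≈-sym a²≈5)
  ... | k , 5≡km with prime⇒irreducible 5-prime (divides k 5≡km)
  ...   | inj₁ refl = congruent refl
  ...   | inj₂ refl = contradiction ∣-refl 5∤m
  even-step m rec 1 _ (congruent ()) _ _ _
  even-step m rec 2 _ _ _ _ a²≈5 with ≈⇒≡+* (n≤1+n 4) (≈-sym a²≈5)
  ... | k , 5≡4+km with refl ← m*n≡1⇒n≡1 k m (sym (+-cancelˡ-≡ 4 _ _ 5≡4+km)) = congruent refl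
  even-step m rec a@(suc (suc (suc a'))) a≤m a-even m-odd 5∤m a²≈5
    with ≈⇒≡+* 5≤a² a²≈5
    where
    5≤a² : 5 ≤ a ^ 2
    5≤a² = ≤-trans (from-yes (5 ≤? 9)) (^-monoˡ-≤ 2 (m≤m+n 3 a'))
  ... | k , a²≡5+km = result
    where
    m*m≡m² : m * m ≡ m ^ 2
    m*m≡m² = cong (m *_) (sym (*-identityʳ m))

    k<m : k < m
    k<m = *-cancelʳ-< m k m (begin-strict
      k * m      <⟨ m<n+m (k * m) {5} z<s ⟩
      5 + k * m  ≡⟨ a²≡5+km ⟨
      a ^ 2      ≤⟨ ^-monoˡ-≤ 2 a≤m ⟩
      m ^ 2      ≡⟨ m*m≡m² ⟨
      m * m      ∎)
      where open ≤-Reasoning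

    km-odd : k * m ≈ 1 [ 2 ]
    -- `k * m + 6` is `1 + a²`, and `a` is even.
    km-odd = ≈-trans (≈-sym (≡+*⇒≈ {a = k * m + 6} 3 refl))
      (≈-trans (≈-reflexive (trans (+-comm (k * m) 6) (cong suc (sym a²≡5+km))))
      (+-cong {a = 1} ≈-refl (^-cong 2 a-even)))

    k-odd : k ≈ 1 [ 2 ]
    k-odd = odd-factorˡ k m km-odd

    m≢0[5] : m % 5 ≢ 0
    m≢0[5] = 5∤m ∘ m%n≡0⇒n∣m m 5

    result : m ^ 2 ≈ 1 [ 5 ]
    result with 5 ∣? k
    -- The same `a` is a square root of 5 modulo `k`, so the induction hypothesis applies to `k`.
    ... | no 5∤k = ≈-trans (^-cong 2 (≈-% m)) (congruent
      (square-quotient₅ (m%n<n a 5) (m%n<n k 5) (m%n<n m 5)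
        (residues (≈-trans (^-cong 2 (≈-sym (≈-% a)))
          (≈-trans a²≈km (*-cong (≈-% k) (≈-% m)))))
        (residues (≈-trans (^-cong 2 (≈-sym (≈-% k)))
          (rec k<m a k-odd 5∤k
            (≡+*⇒≈ m (trans a²≡5+km (cong (λ x → 5 + x) (*-comm k m)))))))
        m≢0[5]))
      where
      instance _ = odd⇒nonZero k-odd

      a²≈km : a ^ 2 ≈ k * m [ 5 ]
      a²≈km = ≡+*⇒≈ 1 (trans a²≡5+km (+-comm 5 (k * m)))
    -- If `k = 5 k′`, then 5 divides `a = 5 b`, and dividing by 5 leaves `5 b² = 1 + k′ m`. So `k′`
    -- is prime to 5 and the induction hypothesis applies to it.
    ... | yes (divides k′ refl) = by-square-root (prime∣^⇒∣ 5-prime 2 (divides (1 + k′ * m)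
      (trans a²≡5+km
        (solve 2 (λ k m → con 5 :+ k :* con 5 :* m := (con 1 :+ k :* m) :* con 5) refl k′ m))))
      where
      k′-odd : k′ ≈ 1 [ 2 ]
      k′-odd = odd-factorˡ k′ 5 k-odd

      instance _ = odd⇒nonZero k′-odd

      by-square-root : 5 ∣ a → m ^ 2 ≈ 1 [ 5 ]
      by-square-root (divides b a≡b5) = ≈-trans (^-cong 2 (≈-% m)) (congruent
        (square-cofactor₅ (m%n<n b 5) (m%n<n k′ 5) (m%n<n m 5)
          (residues (≈-trans (*-cong {a = 5} ≈-refl (^-cong 2 (≈-sym (≈-% b))))
            (≈-trans (≈-reflexive 5b²≡1+k′m) (+-cong {a = 1} ≈-refl (*-cong (≈-% k′) (≈-% m))))))
          (residues (≈-trans (^-cong 2 (≈-sym (≈-% k′)))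
            (rec (≤-<-trans (m≤m*n k′ 5) k<m) a k′-odd 5∤k′
              (≡+*⇒≈ (5 * m) (trans a²≡5+km (cong (λ x → 5 + x)
                (solve 2 (λ k m → k :* con 5 :* m := con 5 :* m :* k) refl k′ m)))))))))
        where
        5b²≡1+k′m : 5 * b ^ 2 ≡ 1 + k′ * m
        5b²≡1+k′m = *-cancelˡ-≡ _ _ 5 (begin
          5 * (5 * b ^ 2)     ≡⟨ solve 1 (λ b → con 5 :* (con 5 :* b :^ 2)
                                         := (b :* con 5) :^ 2) refl b ⟩
          (b * 5) ^ 2         ≡⟨ cong (_^ 2) a≡b5 ⟨
          a ^ 2               ≡⟨ a²≡5+km ⟩
          5 + k′ * 5 * m      ≡⟨ solve 2 (λ k m → con 5 :+ k :* con 5 :* m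
                                           := con 5 :* (con 1 :+ k :* m)) refl k′ m ⟩
          5 * (1 + k′ * m)    ∎)
          where open ≡-Reasoning

        5∤k′ : ¬ 5 ∣ k′
        5∤k′ 5∣k′ with ≈-trans (≈-sym (∣⇒≈0 (m∣m*n (b ^ 2))))
          (≈-trans (≈-reflexive 5b²≡1+k′m) (+-cong {a = 1} ≈-refl (∣⇒≈0 (∣m⇒∣m*n m 5∣k′))))
        ... | congruent ()

  step : ∀ m → (∀ {k} → k < m → P k) → P m
  step m rec a m-odd 5∤m a²≈5 with even-representative m-odd a
  ... | r , r≤m , r-even , r²≈a² = even-step m rec r r≤m r-even m-odd 5∤m (≈-trans r²≈a² a²≈5)

-- Coprime factorisations

coprime-∣ : Coprime m n → k ∣ m → l ∣ n → Coprime k l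
coprime-∣ c k∣m l∣n (d∣k , d∣l) = c (∣-trans d∣k k∣m , ∣-trans d∣l l∣n)

coprime-*ʳ : Coprime k m → Coprime k n → Coprime k (m * n)
coprime-*ʳ c₁ c₂ (d∣k , d∣mn) = c₂ (d∣k , coprime-divisor (coprime-∣ c₁ d∣k ∣-refl) d∣mn)

coprime-^ʳ : ∀ i → Coprime m n → Coprime m (n ^ i)
coprime-^ʳ zero    c = ∣1⇒≡1 ∘ proj₂
coprime-^ʳ (suc i) c = coprime-*ʳ c (coprime-^ʳ i c)

coprime-^ : ∀ i j → Coprime m n → Coprime (m ^ i) (n ^ j)
coprime-^ i j = Coprimality.sym ∘ coprime-^ʳ i ∘ Coprimality.sym ∘ coprime-^ʳ j

prime∤⇒coprime : Prime k → ¬ k ∣ n → Coprime k n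
prime∤⇒coprime k-prime k∤n (d∣k , d∣n) with prime⇒irreducible k-prime d∣k
... | inj₁ d≡1  = d≡1
... | inj₂ refl = contradiction d∣n k∤n

gcd-factors : ∀ m n .{{_ : NonZero m}} →
  ∃ λ g → NonZero g × ∃₂ λ m′ n′ → m ≡ g * m′ × n ≡ g * n′ × Coprime m′ n′
gcd-factors m n =
  gcd m n , g≢0 , m / gcd m n , n / gcd m n ,
  sym (m*[n/m]≡n (gcd[m,n]∣m m n)) , sym (m*[n/m]≡n (gcd[m,n]∣n m n)) , Coprimality.coprime-/gcd m n
  where instance g≢0 = ≢-nonZero (gcd[m,n]≢0 m n (inj₁ (≢-nonZero⁻¹ m)))

-- With `g` the gcd of `a` and `c`, cancellation leaves `a′ b = c′² g`. Since `a′` is prime to `c′`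
-- and `g` to `b`, `a′` and `g` divide each other.
coprime-square : Coprime a b → a * b ≡ c ^ 2 → ∃₂ λ r s → a ≡ r ^ 2 × b ≡ s ^ 2 × r * s ≡ c
coprime-square {zero} {b} {c} co 0≡c²
  with refl ← Coprimality.0-coprimeTo-m⇒m≡1 co | refl ← m^n≡0⇒m≡0 c 2 (sym 0≡c²) =
  0 , 1 , refl , refl , refl
coprime-square {a@(suc _)} {b} {c} co ab≡c² with gcd-factors a c
... | g , g≢0 , a′ , c′ , a≡ga′ , refl , co′ = g , c′ , a≡g² , b≡c′² , refl
  where
  open ≡-Reasoning
  instance _ = g≢0

  a′b≡gc′² : a′ * b ≡ c′ ^ 2 * g
  a′b≡gc′² = *-cancelˡ-≡ _ _ g (begin
    g * (a′ * b)        ≡⟨ *-assoc g a′ b ⟨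
    g * a′ * b          ≡⟨ cong (_* b) a≡ga′ ⟨
    a * b               ≡⟨ ab≡c² ⟩
    (g * c′) ^ 2        ≡⟨ solve 2 (λ g c → (g :* c) :^ 2 := g :* (c :^ 2 :* g)) refl g c′ ⟩
    g * (c′ ^ 2 * g)    ∎)

  a′≡g : a′ ≡ g
  a′≡g = ∣-antisym
    (coprime-divisor (coprime-^ʳ 2 co′) (divides b (trans (sym a′b≡gc′²) (*-comm a′ b))))
    (coprime-divisor (coprime-∣ co (divides a′ (trans a≡ga′ (*-comm g a′))) ∣-refl)
      (divides (c′ ^ 2) (trans (*-comm b a′) a′b≡gc′²)))

  a≡g² : a ≡ g ^ 2
  a≡g² = trans a≡ga′ (cong (g *_) (trans a′≡g (sym (*-identityʳ g))))

  b≡c′² : b ≡ c′ ^ 2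
  b≡c′² = *-cancelˡ-≡ _ _ g (begin
    g * b        ≡⟨ cong (_* b) a′≡g ⟨
    a′ * b       ≡⟨ a′b≡gc′² ⟩
    c′ ^ 2 * g   ≡⟨ *-comm (c′ ^ 2) g ⟩
    g * c′ ^ 2   ∎)

square² : ∀ x → (x ^ 2) ^ 2 ≡ x ^ 4
square² = solve 1 (λ x → (x :^ 2) :^ 2 := x :^ 4) refl

coprime-fourth-power : Coprime a b → a * b ≡ c ^ 4 →
                       ∃₂ λ r s → a ≡ r ^ 4 × b ≡ s ^ 4 × r * s ≡ c
coprime-fourth-power {c = c} co ab≡c⁴
  with coprime-square {_} {_} {c ^ 2} co (trans ab≡c⁴ (sym (square² c)))
... | x , y , refl , refl , xy≡c²
  with coprime-square {x} {y} {c} (coprime-∣ co (m∣m*n (x * 1)) (m∣m*n (y * 1))) xy≡c²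
...   | r , s , refl , refl , rs≡c = r , s , square² r , square² s , rs≡c

-- After division by the gcd, `m′` divides `n′²` and is prime to it, so `m′ = 1`.
m²∣n²⇒m∣n : m ^ 2 ∣ n ^ 2 → m ∣ n
m²∣n²⇒m∣n {zero} {n} 0∣n² with refl ← m^n≡0⇒m≡0 n 2 (0∣⇒≡0 0∣n²) = ∣-refl
m²∣n²⇒m∣n {m@(suc _)} {n} m²∣n² with gcd-factors m n
... | g , g≢0 , m′ , n′ , m≡gm′ , refl , co = divides n′ (trans (*-comm g n′) (cong (n′ *_) g≡m))
  where
  instance _ = m*n≢0 g g {{g≢0}} {{g≢0}}

  m′²∣n′² : m′ ^ 2 ∣ n′ ^ 2
  m′²∣n′² = *-cancelˡ-∣ (g * g) (subst₂ _∣_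
    (trans (cong (_^ 2) m≡gm′) (square-* m′)) (square-* n′) m²∣n²)
    where
    square-* : ∀ m → (g * m) ^ 2 ≡ g * g * m ^ 2
    square-* m = solve 2 (λ g m → (g :* m) :^ 2 := g :* g :* m :^ 2) refl g m

  m′≡1 : m′ ≡ 1
  m′≡1 = coprime-^ʳ 2 co (∣-refl , ∣-trans (m∣m*n (m′ * 1)) m′²∣n′²)

  g≡m : g ≡ m
  g≡m = sym (trans m≡gm′ (trans (cong (g *_) m′≡1) (*-identityʳ g)))

-- If `k` divided `n`, then `k²` would divide `k m` and `k` would divide `m`. So `n²` is prime to
-- `k`.
square∣prime*⇒square∣ : Prime k → ¬ k ∣ m → n ^ 2 ∣ k * m → n ^ 2 ∣ m
square∣prime*⇒square∣ {k} {m} {n} k-prime k∤m n²∣km =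
  coprime-divisor (Coprimality.sym (coprime-^ʳ 2 (prime∤⇒coprime k-prime k∤n))) n²∣km
  where
  instance _ = prime⇒nonZero k-prime
  k∤n : ¬ k ∣ n
  k∤n k∣n = k∤m (*-cancelˡ-∣ k (∣-trans (*-pres-∣ k∣n (∣-trans k∣n (m∣m*n 1))) n²∣km))

split-prime : Prime k → u * v ≡ k * c →
  (∃ λ u′ → u ≡ k * u′ × u′ * v ≡ c) ⊎ (∃ λ v′ → v ≡ k * v′ × u * v′ ≡ c)
split-prime {k} {u} {v} {c} k-prime uv≡kc
  with euclidsLemma u v k-prime (divides c (trans uv≡kc (*-comm k c)))
... | inj₁ (divides u′ refl) = inj₁ (u′ , *-comm u′ k ,
  *-cancelˡ-≡ _ _ k {{prime⇒nonZero k-prime}}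
    (trans (solve 3 (λ k u v → k :* (u :* v) := u :* k :* v) refl k u′ v) uv≡kc))
... | inj₂ (divides v′ refl) = inj₂ (v′ , *-comm v′ k ,
  *-cancelˡ-≡ _ _ k {{prime⇒nonZero k-prime}}
    (trans (solve 3 (λ k u v → k :* (u :* v) := u :* (v :* k)) refl k u v′) uv≡kc))

split-4 : ¬ 2 ∣ v → u * v ≡ 4 * c → ∃ λ u′ → u ≡ 4 * u′ × u′ * v ≡ c
split-4 {v} {u} {c} 2∤v uv≡4c
  with split-prime {2} {u} {v} {2 * c} 2-prime (trans uv≡4c (*-assoc 2 2 c))
... | inj₂ (v′ , refl , _) = contradiction (m∣m*n v′) 2∤v
... | inj₁ (u₁ , refl , u₁v≡2c) with split-prime {2} {u₁} {v} {c} 2-prime u₁v≡2c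
...   | inj₂ (v′ , refl , _)      = contradiction (m∣m*n v′) 2∤v
...   | inj₁ (u₂ , refl , u₂v≡c) = u₂ , sym (*-assoc 2 2 u₂) , u₂v≡c

square-≤ : a ^ 2 ≤ b ^ 2 → a ≤ b
square-≤ a²≤b² = ≮⇒≥ (λ b<a → <⇒≱ (^-monoˡ-< 2 b<a) a²≤b²)

-- Bézout gives `w t ≡ 1` or `w t ≡ -1`; squaring removes the sign.
square-inverse : ∀ {t m} .{{_ : NonZero m}} → Coprime t m → ∃ λ w → (w * t) ^ 2 ≈ 1 [ m ]
square-inverse {t} {m} co with Coprimality.coprime-Bézout co
... | Bézout.+- x y eq = x , ^-cong 2 (≡+*⇒≈ y (sym eq))
... | Bézout.-+ x y eq = x ,
  -- From `1 + z ≡ 0`: `z² ≡ z² + (1 + z) = z (1 + z) + 1 ≡ 1`.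
  ≈-trans (≈-reflexive (sym (+-identityʳ (z ^ 2))))
  (≈-trans (+-cong {a = z ^ 2} ≈-refl (≈-sym 1+z≈0))
  (≈-trans (≈-reflexive
    (solve 1 (λ z → z :^ 2 :+ (con 1 :+ z) := z :* (con 1 :+ z) :+ con 1) refl z))
  (+-cong (≈-trans (*-cong {a = z} ≈-refl 1+z≈0) (≈-reflexive (*-zeroʳ z))) ≈-refl)))
  where
  z = x * t
  1+z≈0 : 1 + z ≈ 0 [ m ]
  1+z≈0 = ≡+*⇒≈ y eq

-- Multiplying by `w²`, where `(w t)² ≡ 1`, makes 5 itself the square of `w s` modulo `m`.
5t²-residue⇒±1 : ∀ {m s t} .{{_ : NonZero m}} → m ≈ 1 [ 2 ] → ¬ 5 ∣ m → Coprime t m →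
                 s ^ 2 ≈ 5 * t ^ 2 [ m ] → m ^ 2 ≈ 1 [ 5 ]
5t²-residue⇒±1 {m} {s} {t} m-odd 5∤m co s²≈5t² with square-inverse co
... | w , wt²≈1 = 5-residue⇒±1 m (w * s) m-odd 5∤m
  (≈-trans (≈-reflexive (solve 2 (λ w s → (w :* s) :^ 2 := w :^ 2 :* s :^ 2) refl w s))
  (≈-trans (*-cong {a = w ^ 2} ≈-refl s²≈5t²)
  (≈-trans (≈-reflexive
    (solve 2 (λ w t → w :^ 2 :* (con 5 :* t :^ 2) := con 5 :* (w :* t) :^ 2) refl w t))
  (*-cong {a = 5} ≈-refl wt²≈1))))

-- Local obstructions modulo 4, 5 and 8

private
  -- Fourth powers are 0 or 1 modulo 4. For odd `x` the left side is 1 or 2, while the right side is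
  -- 0 or 3.
  mod4 : ∀ {x} → x < 4 → ∀ {r} → r < 4 → ∀ {s} → s < 4 →
    (x ^ 2 + r ^ 4) % 4 ≡ (3 * s ^ 4) % 4 → x % 2 ≢ 1
  mod4 = from-yes (allUpTo? (λ x → allUpTo? (λ r → allUpTo? (λ s →
    (x ^ 2 + r ^ 4) % 4 ≟ (3 * s ^ 4) % 4 →-dec ¬? (x % 2 ≟ 1)) 4) 4) 4)

  -- A nonzero `t` has `t⁴ ≡ 1`, and 3 is not a square modulo 5.
  mod5 : ∀ {x} → x < 5 → ∀ {t} → t < 5 → x ^ 2 % 5 ≡ (3 * t ^ 4) % 5 → t ≡ 0
  mod5 = from-yes (allUpTo? (λ x → allUpTo? (λ t →
    x ^ 2 % 5 ≟ (3 * t ^ 4) % 5 →-dec t ≟ 0) 5) 5)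

  -- For odd `e`, `e⁴ ≡ 1`, and `m⁴` is 0 or 1; so `n²` would be 5 or 6, but squares modulo 8 are 0,
  -- 1 and 4.
  mod8 : ∀ {n} → n < 8 → ∀ {e} → e < 8 → ∀ {m} → m < 8 →
    (n ^ 2 + 3 * e ^ 4) % 8 ≡ m ^ 4 % 8 → e % 2 ≡ 0
  mod8 = from-yes (allUpTo? (λ n → allUpTo? (λ e → allUpTo? (λ m →
    (n ^ 2 + 3 * e ^ 4) % 8 ≟ m ^ 4 % 8 →-dec e % 2 ≟ 0) 8) 8) 8)

odd²+r⁴≉3s⁴[4] : ∀ x r s → x ≈ 1 [ 2 ] → ¬ x ^ 2 + r ^ 4 ≈ 3 * s ^ 4 [ 4 ]
odd²+r⁴≉3s⁴[4] x r s (congruent x-odd) p = mod4 (m%n<n x 4) (m%n<n r 4) (m%n<n s 4)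
  (residues (≈-trans (+-cong (^-cong 2 (≈-sym (≈-% x))) (^-cong 4 (≈-sym (≈-% r))))
  (≈-trans p (*-cong {a = 3} ≈-refl (^-cong 4 (≈-% s))))))
  (trans (m∣n⇒o%n%m≡o%m 2 4 x (divides 2 refl)) x-odd)

x²≈3t⁴[5]⇒5∣t : ∀ x t → x ^ 2 ≈ 3 * t ^ 4 [ 5 ] → 5 ∣ t
x²≈3t⁴[5]⇒5∣t x t p = m%n≡0⇒n∣m t 5 (mod5 (m%n<n x 5) (m%n<n t 5)
  (residues (≈-trans (^-cong 2 (≈-sym (≈-% x)))
  (≈-trans p (*-cong {a = 3} ≈-refl (^-cong 4 (≈-% t)))))))

n²+3e⁴≈m⁴[8]⇒2∣e : ∀ n e m → n ^ 2 + 3 * e ^ 4 ≈ m ^ 4 [ 8 ] → 2 ∣ e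
n²+3e⁴≈m⁴[8]⇒2∣e n e m p = m%n≡0⇒n∣m e 2 (trans (sym (m∣n⇒o%n%m≡o%m 2 8 e (divides 4 refl)))
  (mod8 (m%n<n n 8) (m%n<n e 8) (m%n<n m 8)
    (residues (≈-trans (+-cong (^-cong 2 (≈-sym (≈-% n)))
      (*-cong {a = 3} ≈-refl (^-cong 4 (≈-sym (≈-% e)))))
    (≈-trans p (^-cong 4 (≈-% m)))))))

-- Distribution of primes over two factors

infixr 8 _if_

-- `k` with exponent 0 or 1, recording whether a prime goes into a given factor.
_if_ : ℕ → Bool → ℕ
k if x = if x then k else 1

if≈1 : ∀ {d} .{{_ : NonZero d}} x → k ≈ 1 [ d ] → k if x ≈ 1 [ d ]
if≈1 true  k≈1 = k≈1
if≈1 false _   = ≈-refl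

distribute-prime : Prime k → u * v ≡ k * c → ∃ λ x → ∃₂ λ u′ v′ →
  u ≡ k if x * u′ × v ≡ k if not x * v′ × u′ * v′ ≡ c
distribute-prime {k} {u} {v} k-prime uv≡kc with split-prime k-prime uv≡kc
... | inj₁ (u′ , u≡ku′ , u′v≡c) = true  , u′ , v , u≡ku′ , sym (*-identityˡ v) , u′v≡c
... | inj₂ (v′ , v≡kv′ , uv′≡c) = false , u , v′ , sym (*-identityˡ u) , v≡kv′ , uv′≡c

-- Infinite descent on n² + D e⁴ = m⁴

module Descent
  (p q : ℕ) (p-prime : Prime p) (q-prime : Prime q) (p≢q : p ≢ q)
  (p≡33 : p % 40 ≡ 33) (q≡7 : q % 40 ≡ 7)
  where

  instance
    q-nonZero : NonZero q
    q-nonZero = prime⇒nonZero q-prime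

  D : ℕ
  D = 5 * p * q

  p≈1[4] : p ≈ 1 [ 4 ]
  p≈1[4] = ≈-trans (%≡⇒≈ 4 40 (divides 10 refl) p≡33) (congruent refl)

  p≈1[8] : p ≈ 1 [ 8 ]
  p≈1[8] = ≈-trans (%≡⇒≈ 8 40 (divides 5 refl) p≡33) (congruent refl)

  p≈3[5] : p ≈ 3 [ 5 ]
  p≈3[5] = ≈-trans (%≡⇒≈ 5 40 (divides 8 refl) p≡33) (congruent refl)

  q≈1[2] : q ≈ 1 [ 2 ]
  q≈1[2] = ≈-trans (%≡⇒≈ 2 40 (divides 20 refl) q≡7) (congruent refl)

  q≈3[4] : q ≈ 3 [ 4 ]
  q≈3[4] = ≈-trans (%≡⇒≈ 4 40 (divides 10 refl) q≡7) (congruent refl)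

  q≈2[5] : q ≈ 2 [ 5 ]
  q≈2[5] = ≈-trans (%≡⇒≈ 5 40 (divides 8 refl) q≡7) (congruent refl)

  D≈3[8] : D ≈ 3 [ 8 ]
  D≈3[8] = ≈-trans (*-cong (*-cong {a = 5} ≈-refl p≈1[8]) (%≡⇒≈ 8 40 (divides 5 refl) q≡7))
    (congruent refl)

  5∤q : ¬ 5 ∣ q
  5∤q 5∣q with ≈-trans (≈-sym q≈2[5]) (∣⇒≈0 5∣q)
  ... | congruent ()

  5∤pq : ¬ 5 ∣ p * q
  5∤pq 5∣pq with ≈-trans (≈-sym (*-cong p≈3[5] q≈2[5])) (∣⇒≈0 5∣pq)
  ... | congruent ()

  p∤q : ¬ p ∣ q
  p∤q p∣q with prime⇒irreducible q-prime p∣q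
  ... | inj₁ refl = ¬prime[1] p-prime
  ... | inj₂ p≡q  = p≢q p≡q

  -- The distinct primes 5, `p` and `q` are peeled off one after another.
  square∣D⇒≡1 : d ^ 2 ∣ D → d ≡ 1
  square∣D⇒≡1 {d} d²∣D = ∣1⇒≡1 (∣-trans (m∣m*n (d * 1))
    (square∣prime*⇒square∣ {m = 1} {n = d} q-prime q∤1
    (subst (d ^ 2 ∣_) (sym (*-identityʳ q))
    (square∣prime*⇒square∣ {n = d} p-prime p∤q
    (square∣prime*⇒square∣ {n = d} 5-prime 5∤pq
    (subst (d ^ 2 ∣_) (*-assoc 5 p q) d²∣D))))))
    where
    q∤1 : ¬ q ∣ 1
    q∤1 q∣1 = ¬prime[1] (subst Prime (∣1⇒≡1 q∣1) q-prime)

  -- A common divisor `d` of `u` and `v` is prime to `e`, so `d²`, which divides `D e⁴`, divides the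
  -- squarefree `D`.
  coprime-cofactors : ∀ {x e} → Coprime x e → (∀ {d} → d ∣ u → d ∣ v → d ∣ x ^ 2) →
                      u * v ∣ D * e ^ 4 → Coprime u v
  coprime-cofactors {x = x} {e} co d∣x² uv∣De⁴ {d} (d∣u , d∣v) = square∣D⇒≡1
    (coprime-divisor d²⊥e⁴ (subst (d ^ 2 ∣_) (*-comm D (e ^ 4))
      (∣-trans (*-pres-∣ d∣u (subst (_∣ _) (sym (*-identityʳ d)) d∣v)) uv∣De⁴)))
    where
    d²⊥e⁴ : Coprime (d ^ 2) (e ^ 4)
    d²⊥e⁴ = Coprimality.sym (coprime-^ʳ 2 (Coprimality.sym
      (coprime-∣ (coprime-^ {x} {e} 2 4 co) (d∣x² d∣u d∣v) ∣-refl)))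

  -- `x`, `y`, `z` tell whether 5, `p`, `q` go to `u`; what remains are coprime factors of `c⁴`,
  -- hence fourth powers.
  distribute : Coprime u v → u * v ≡ D * c ^ 4 → ∃ λ x → ∃ λ y → ∃ λ z → ∃₂ λ r s →
    u ≡ 5 if x * (p if y * (q if z * r ^ 4)) ×
    v ≡ 5 if not x * (p if not y * (q if not z * s ^ 4)) ×
    r * s ≡ c
  distribute {u} {v} {c} co uv≡Dc⁴
    with distribute-prime {5} {u} {v} {p * (q * c ^ 4)} 5-prime (trans uv≡Dc⁴
      (solve 3 (λ p q t → con 5 :* p :* q :* t := con 5 :* (p :* (q :* t))) refl p q (c ^ 4)))
  ... | x , u₁ , v₁ , refl , refl , eq₁ with distribute-prime {p} {u₁} {v₁} {q * c ^ 4} p-prime eq₁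
  ... | y , u₂ , v₂ , refl , refl , eq₂ with distribute-prime {q} {u₂} {v₂} {c ^ 4} q-prime eq₂
  ... | z , u₃ , v₃ , refl , refl , eq₃
    with coprime-fourth-power {u₃} {v₃} {c}
      (coprime-∣ co (cofactor∣ x y z) (cofactor∣ (not x) (not y) (not z))) eq₃
    where
    cofactor∣ : ∀ x y z {t} → t ∣ 5 if x * (p if y * (q if z * t))
    cofactor∣ x y z = ∣n⇒∣m*n (5 if x) (∣n⇒∣m*n (p if y) (n∣m*n (q if z)))
  ... | r , s , refl , refl , rs≡c = x , y , z , r , s , refl , refl , rs≡c

  -- Of the eight factorisations u = d₁ r⁴, v = d₂ s⁴ with d₁ d₂ = 5pq, those with
  -- q ∣ d₂ fail modulo 4, d₂ = p and d₂ = 5p fail modulo 5, and d₂ = 5 fails modulo q.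
  D∣u : ∀ x → Coprime u v → u * v ≡ D * c ^ 4 →
    (∀ r s → u ≈ r ^ 4 [ 4 ] → ¬ v ≈ 3 * s ^ 4 [ 4 ]) →
    x ^ 2 ≈ 4 * u + v [ 5 ] →
    (q ∣ u → x ^ 2 ≈ v [ q ]) →
    ∃₂ λ r s → u ≡ D * r ^ 4 × v ≡ s ^ 4 × r * s ≡ c
  D∣u {u} {v} {c} x co uv≡Dc⁴ mod-4 mod-5 mod-q with distribute {u} {v} {c} co uv≡Dc⁴
  -- `q` goes to `v`. Modulo 4, 5 and `p` are 1 and `q` is 3, so `u ≡ r⁴` and `v ≡ 3 s⁴`.
  ... | x₅ , xₚ , false , r , s , refl , refl , _ = contradiction
    (≈-trans (*-cong (if≈1 (not x₅) (congruent refl))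
        (*-cong (if≈1 (not xₚ) p≈1[4]) (*-cong q≈3[4] ≈-refl)))
      (≈-reflexive (solve 1 (λ t → con 1 :* (con 1 :* (con 3 :* t)) := con 3 :* t) refl (s ^ 4))))
    (mod-4 r s (≈-trans (*-cong (if≈1 x₅ (congruent refl)) (*-cong (if≈1 xₚ p≈1[4]) ≈-refl))
      (≈-reflexive (solve 1 (λ t → con 1 :* (con 1 :* (con 1 :* t)) := t) refl (r ^ 4)))))
  ... | true , true , true , r , s , refl , refl , rs≡c = r , s ,
    solve 3 (λ p q t → con 5 :* (p :* (q :* t)) := con 5 :* p :* q :* t) refl p q (r ^ 4) ,
    solve 1 (λ t → con 1 :* (con 1 :* (con 1 :* t)) := t) refl (s ^ 4) , rs≡c
  -- `u = 5 q r⁴` and `v = p s⁴`: `x² ≡ 3 s⁴` modulo 5 puts 5 into `s`, hence into both `u` and `v`.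
  ... | true , false , true , r , s , refl , refl , _ =
    contradiction (co (m∣m*n (1 * (q * r ^ 4)) , 5∣v)) λ ()
    where
    v′ = 1 * (p * (1 * s ^ 4))
    x²≈3s⁴ : x ^ 2 ≈ 3 * s ^ 4 [ 5 ]
    x²≈3s⁴ = ≈-trans mod-5 (+-cong (*-cong {a = 4} ≈-refl (∣⇒≈0 (m∣m*n (1 * (q * r ^ 4)))))
      (≈-trans (*-cong {a = 1} ≈-refl (*-cong p≈3[5] ≈-refl))
      (≈-reflexive (solve 1 (λ t → con 1 :* (con 3 :* (con 1 :* t)) := con 3 :* t) refl (s ^ 4)))))
    5∣v : 5 ∣ v′
    5∣v = ∣n⇒∣m*n 1 (∣n⇒∣m*n p (∣n⇒∣m*n 1 (∣m⇒∣m*n {m = s} (s ^ 3) (x²≈3t⁴[5]⇒5∣t x s x²≈3s⁴))))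
  -- `u = q r⁴` and `v = 5 p s⁴`: modulo 5, `x² ≡ 4 · 2 r⁴ ≡ 3 r⁴`, so 5 again divides both.
  ... | false , false , true , r , s , refl , refl , _ =
    contradiction (co (5∣u , m∣m*n (p * (1 * s ^ 4)))) λ ()
    where
    u′ = 1 * (1 * (q * r ^ 4))
    x²≈3r⁴ : x ^ 2 ≈ 3 * r ^ 4 [ 5 ]
    x²≈3r⁴ = ≈-trans mod-5
      (≈-trans (+-cong
        (*-cong {a = 4} ≈-refl (*-cong {a = 1} ≈-refl
          (*-cong {a = 1} ≈-refl (*-cong q≈2[5] ≈-refl))))
        (∣⇒≈0 (m∣m*n (p * (1 * s ^ 4)))))
      (≡+*⇒≈ (r ^ 4) (solve 1 (λ t → con 4 :* (con 1 :* (con 1 :* (con 2 :* t))) :+ con 0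
                                   := con 3 :* t :+ t :* con 5) refl (r ^ 4))))
    5∣u : 5 ∣ u′
    5∣u = ∣n⇒∣m*n 1 (∣n⇒∣m*n 1 (∣n⇒∣m*n q (∣m⇒∣m*n {m = r} (r ^ 3) (x²≈3t⁴[5]⇒5∣t x r x²≈3r⁴))))
  -- `u = p q r⁴` and `v = 5 s⁴`: `x² ≡ 5 (s²)²` modulo `q` would give `q² ≡ 1` modulo 5, but
  -- `q² ≡ 4`.
  ... | false , true , true , r , s , refl , refl , _ =
    contradiction (≈-trans (≈-sym (^-cong 2 q≈2[5])) (5t²-residue⇒±1 {s = x} {t = s ^ 2} q≈1[2] 5∤q
      (coprime-∣ (Coprimality.sym co) s²∣v q∣u)
      (≈-trans (mod-q q∣u) (≈-reflexive
        (solve 1 (λ s → con 5 :* (con 1 :* (con 1 :* s :^ 4)) := con 5 :* (s :^ 2) :^ 2) refl s)))))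
      λ { (congruent ()) }
    where
    q∣u : q ∣ 1 * (p * (q * r ^ 4))
    q∣u = ∣n⇒∣m*n 1 (∣n⇒∣m*n p (m∣m*n (r ^ 4)))
    s²∣v : s ^ 2 ∣ 5 * (1 * (1 * s ^ 4))
    s²∣v = divides (5 * s ^ 2)
      (solve 1 (λ s → con 5 :* (con 1 :* (con 1 :* s :^ 4)) := con 5 :* s :^ 2 :* s :^ 2) refl s)

  odd-summand : ∀ {x y z} → x + y ≡ z → x ≈ 1 [ 2 ] → z ≈ 1 [ 2 ] → 2 ∣ y
  odd-summand {x} {y} refl x-odd z-odd with odd-or-even y
  ... | inj₁ even = ≈0⇒∣ even
  ... | inj₂ odd with ≈-trans (≈-sym z-odd) (+-cong x-odd odd)
  ...   | congruent ()

  -- Writing `m = s² + 2 a` gives `a (a + s²) = D r⁴` with coprime factors. By `D∣u` they are `D k⁴`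
  -- and `l⁴`, and their difference is `s²`.
  descent₂ : ∀ {s r m} → Coprime s r → s ≈ 1 [ 2 ] → s ^ 4 + 4 * (D * r ^ 4) ≡ m ^ 2 →
             ∃₂ λ k l → s ^ 2 + D * k ^ 4 ≡ l ^ 4 × Coprime l k × k * l ≡ r
  descent₂ {s} {r} {m} co s-odd eq with m≤n⇒∃[o]m+o≡n s²≤m
    where
    s²≤m : s ^ 2 ≤ m
    s²≤m = square-≤ (begin
      (s ^ 2) ^ 2                ≡⟨ square² s ⟩
      s ^ 4                      ≤⟨ m≤m+n (s ^ 4) _ ⟩
      s ^ 4 + 4 * (D * r ^ 4)    ≡⟨ eq ⟩
      m ^ 2                      ∎)
      where open ≤-Reasoning
  ... | o , s²+o≡m with odd-summand s²+o≡m (^-cong 2 s-odd) m-odd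
    where
    m-odd : m ≈ 1 [ 2 ]
    m-odd = odd-factorˡ m (m * 1) (≈-trans (≈-reflexive (sym eq))
      (+-cong (^-cong 4 s-odd) (∣⇒≈0 (∣m⇒∣m*n (D * r ^ 4) (divides 2 refl)))))
  ... | divides a refl = conclude (D∣u s at-coprime at≡Dr⁴ mod-4 mod-5 mod-q)
    where
    t = a + s ^ 2

    at≡Dr⁴ : a * t ≡ D * r ^ 4
    at≡Dr⁴ = *-cancelˡ-≡ _ _ 4 (+-cancelˡ-≡ (s ^ 4) _ _ (begin
      s ^ 4 + 4 * (a * t)      ≡⟨ solve 2 (λ s a → s :^ 4 :+ con 4 :* (a :* (a :+ s :^ 2))
                                              := (s :^ 2 :+ a :* con 2) :^ 2) refl s a ⟩
      (s ^ 2 + a * 2) ^ 2      ≡⟨ cong (_^ 2) s²+o≡m ⟩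
      m ^ 2                    ≡⟨ eq ⟨
      s ^ 4 + 4 * (D * r ^ 4)  ∎))
      where open ≡-Reasoning

    at-coprime : Coprime a t
    at-coprime = coprime-cofactors co (λ d∣a d∣t → ∣m+n∣m⇒∣n d∣t d∣a) (∣-reflexive at≡Dr⁴)

    mod-4 : ∀ k l → a ≈ k ^ 4 [ 4 ] → ¬ t ≈ 3 * l ^ 4 [ 4 ]
    -- Since `t = a + s²`, this would read `s² + k⁴ ≡ 3 l⁴` with `s` odd.
    mod-4 k l a≈k⁴ t≈3l⁴ = odd²+r⁴≉3s⁴[4] s k l s-odd
      (≈-trans (+-cong {a = s ^ 2} ≈-refl (≈-sym a≈k⁴))
      (≈-trans (≈-reflexive (+-comm (s ^ 2) a)) t≈3l⁴))

    mod-5 : s ^ 2 ≈ 4 * a + t [ 5 ]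
    mod-5 = ≈-sym (≡+*⇒≈ a
      (solve 2 (λ a x → con 4 :* a :+ (a :+ x) := x :+ a :* con 5) refl a (s ^ 2)))

    mod-q : q ∣ a → s ^ 2 ≈ t [ q ]
    mod-q q∣a = ≈-sym (+-cong (∣⇒≈0 q∣a) ≈-refl)

    conclude : (∃₂ λ k l → a ≡ D * k ^ 4 × t ≡ l ^ 4 × k * l ≡ r) →
               ∃₂ λ k l → s ^ 2 + D * k ^ 4 ≡ l ^ 4 × Coprime l k × k * l ≡ r
    conclude (k , l , a≡Dk⁴ , t≡l⁴ , kl≡r) = k , l ,
      trans (+-comm (s ^ 2) _) (trans (cong (_+ s ^ 2) (sym a≡Dk⁴)) t≡l⁴) ,
      coprime-∣ (Coprimality.sym at-coprime)
        (subst (l ∣_) (sym t≡l⁴) (m∣m*n (l ^ 3)))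
        (subst (k ∣_) (sym a≡Dk⁴) (∣n⇒∣m*n D (m∣m*n (k ^ 3)))) ,
      kl≡r

  -- The conditions of `D∣u` hold with `x = m`, each being a reduction of `4 u + v = m²`.
  descent₁′ : ∀ {u v f m} → Coprime u v → u * v ≡ D * f ^ 4 → 4 * u + v ≡ m ^ 2 → v ≈ 1 [ 2 ] →
              ∃₂ λ r s → s ^ 4 + 4 * (D * r ^ 4) ≡ m ^ 2 × Coprime s r × s ≈ 1 [ 2 ] × r * s ≡ f
  descent₁′ {u} {v} {f} {m} co uv≡Df⁴ 4u+v≡m² v-odd = conclude (D∣u m co uv≡Df⁴ mod-4 mod-5 mod-q)
    where
    m-odd : m ≈ 1 [ 2 ]
    m-odd = odd-factorˡ m (m * 1) (≈-trans (≈-reflexive (sym 4u+v≡m²))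
      (+-cong (∣⇒≈0 (∣m⇒∣m*n u (divides 2 refl))) v-odd))

    mod-4 : ∀ r s → u ≈ r ^ 4 [ 4 ] → ¬ v ≈ 3 * s ^ 4 [ 4 ]
    -- Modulo 4 the equation is `m² ≡ v`, so the obstruction applies with fourth power 0.
    mod-4 r s _ v≈3s⁴ = odd²+r⁴≉3s⁴[4] m 0 s m-odd
      (≈-trans (≈-reflexive (trans (+-identityʳ (m ^ 2)) (sym 4u+v≡m²)))
      (+-cong (∣⇒≈0 (m∣m*n u)) v≈3s⁴))

    mod-5 : m ^ 2 ≈ 4 * u + v [ 5 ]
    mod-5 = ≈-reflexive (sym 4u+v≡m²)

    mod-q : q ∣ u → m ^ 2 ≈ v [ q ]
    mod-q q∣u = ≈-trans (≈-reflexive (sym 4u+v≡m²)) (+-cong (∣⇒≈0 (∣n⇒∣m*n 4 q∣u)) ≈-refl)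

    conclude : (∃₂ λ r s → u ≡ D * r ^ 4 × v ≡ s ^ 4 × r * s ≡ f) →
               ∃₂ λ r s → s ^ 4 + 4 * (D * r ^ 4) ≡ m ^ 2 × Coprime s r × s ≈ 1 [ 2 ] × r * s ≡ f
    conclude (r , s , refl , refl , rs≡f) = r , s ,
      trans (+-comm (s ^ 4) _) 4u+v≡m² ,
      coprime-∣ (Coprimality.sym co) (m∣m*n (s ^ 3)) (∣n⇒∣m*n D (m∣m*n (r ^ 3))) ,
      odd-factorˡ s (s ^ 3) v-odd ,
      rs≡f

  -- Modulo 8, `e = 2 f`, so `m` and `n` are odd. With `m² - n = 2 u` and `m² + n = 2 w` one gets
  -- `u w = 4 D f⁴` and `u + w = m²`; `u` and `w` are coprime, so the even one carries the whole
  -- factor 4.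
  descent₁ : ∀ {n e m} → Coprime m e → n ^ 2 + D * e ^ 4 ≡ m ^ 4 →
             ∃₂ λ r s → s ^ 4 + 4 * (D * r ^ 4) ≡ m ^ 2 × Coprime s r × s ≈ 1 [ 2 ] × r * s * 2 ≡ e
  descent₁ {n} {e} {m} co eq with n²+3e⁴≈m⁴[8]⇒2∣e n e m
    (≈-trans (+-cong {a = n ^ 2} ≈-refl (*-cong (≈-sym D≈3[8]) ≈-refl)) (≈-reflexive eq))
  ... | divides f refl with m≤n⇒∃[o]m+o≡n n≤m²
    where
    n≤m² : n ≤ m ^ 2
    n≤m² = square-≤ (begin
      n ^ 2                  ≤⟨ m≤m+n (n ^ 2) _ ⟩
      n ^ 2 + D * e ^ 4      ≡⟨ eq ⟩
      m ^ 4                  ≡⟨ square² m ⟨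
      (m ^ 2) ^ 2            ∎)
      where open ≤-Reasoning
  ... | o , n+o≡m² with odd-summand n+o≡m² n-odd (^-cong 2 m-odd)
    where
    m-odd : m ≈ 1 [ 2 ]
    m-odd with odd-or-even m
    ... | inj₂ odd  = odd
    ... | inj₁ even = contradiction (co (≈0⇒∣ even , n∣m*n f)) λ ()

    n-odd : n ≈ 1 [ 2 ]
    n-odd = odd-factorˡ n (n * 1) (≈-trans (≈-reflexive (sym (+-identityʳ (n ^ 2))))
      (≈-trans (+-cong {a = n ^ 2} ≈-refl (≈-sym (∣⇒≈0 (∣n⇒∣m*n D (∣m⇒∣m*n (e ^ 3) (n∣m*n f))))))
      (≈-trans (≈-reflexive eq) (^-cong 4 m-odd))))
  ... | divides u refl = conclude
    where
    w = u + n

    u+w≡m² : u + w ≡ m ^ 2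
    u+w≡m² = trans (solve 2 (λ u n → u :+ (u :+ n) := n :+ u :* con 2) refl u n) n+o≡m²

    De⁴≡16Df⁴ : D * (f * 2) ^ 4 ≡ 4 * (4 * (D * f ^ 4))
    De⁴≡16Df⁴ =
      solve 2 (λ D f → D :* (f :* con 2) :^ 4 := con 4 :* (con 4 :* (D :* f :^ 4))) refl D f

    uw≡4Df⁴ : u * w ≡ 4 * (D * f ^ 4)
    uw≡4Df⁴ = *-cancelˡ-≡ _ _ 4 (+-cancelˡ-≡ (n ^ 2) _ _ (begin
      n ^ 2 + 4 * (u * w)              ≡⟨ solve 2 (λ n u → n :^ 2 :+ con 4 :* (u :* (u :+ n))
                                                      := (n :+ u :* con 2) :^ 2) refl n u ⟩
      (n + u * 2) ^ 2                  ≡⟨ cong (_^ 2) n+o≡m² ⟩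
      (m ^ 2) ^ 2                      ≡⟨ square² m ⟩
      m ^ 4                            ≡⟨ eq ⟨
      n ^ 2 + D * (f * 2) ^ 4          ≡⟨ cong (λ x → n ^ 2 + x) De⁴≡16Df⁴ ⟩
      n ^ 2 + 4 * (4 * (D * f ^ 4))    ∎))
      where open ≡-Reasoning

    uw-coprime : Coprime u w
    uw-coprime = coprime-cofactors co (λ {d} d∣u d∣w → subst (d ∣_) u+w≡m² (∣m∣n⇒∣m+n d∣u d∣w))
      (divides 4 (trans De⁴≡16Df⁴ (cong (4 *_) (sym uw≡4Df⁴))))

    not-even⇒odd : ∀ {x} → ¬ 2 ∣ x → x ≈ 1 [ 2 ]
    not-even⇒odd {x} 2∤x with odd-or-even x
    ... | inj₂ odd  = odd
    ... | inj₁ even = contradiction (≈0⇒∣ even) 2∤x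

    -- `x` and `y` stand for `u` and `w` in either order, `y` being the odd one.
    by-odd-factor : ∀ x y → ¬ 2 ∣ y → Coprime x y → x * y ≡ 4 * (D * f ^ 4) → x + y ≡ m ^ 2 →
      ∃₂ λ r s → s ^ 4 + 4 * (D * r ^ 4) ≡ m ^ 2 × Coprime s r × s ≈ 1 [ 2 ] × r * s * 2 ≡ e
    by-odd-factor x y 2∤y xy-coprime xy≡4Df⁴ x+y≡m² with split-4 {y} {x} {D * f ^ 4} 2∤y xy≡4Df⁴
    ... | x′ , refl , x′y≡Df⁴
      with descent₁′ {x′} {y} {f} {m} (coprime-∣ xy-coprime (n∣m*n 4) ∣-refl)
             x′y≡Df⁴ x+y≡m² (not-even⇒odd 2∤y)
    ... | r , s , eq′ , sr-coprime , s-odd , rs≡f =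
      r , s , eq′ , sr-coprime , s-odd , cong (_* 2) rs≡f

    conclude : ∃₂ λ r s → s ^ 4 + 4 * (D * r ^ 4) ≡ m ^ 2 ×
                          Coprime s r × s ≈ 1 [ 2 ] × r * s * 2 ≡ e
    conclude with 2 ∣? w
    ... | no  2∤w = by-odd-factor u w 2∤w uw-coprime uw≡4Df⁴ u+w≡m²
    ... | yes 2∣w = by-odd-factor w u (λ 2∣u → contradiction (uw-coprime (2∣u , 2∣w)) λ ())
      (Coprimality.sym uw-coprime) (trans (*-comm w u) uw≡4Df⁴) (trans (+-comm w u) u+w≡m²)

  NoCoprimeSolution : ℕ → Set
  NoCoprimeSolution e = .{{_ : NonZero e}} → ∀ n m → Coprime m e → n ^ 2 + D * e ^ 4 ≢ m ^ 4

  -- The two descents replace `(n, e, m)` by `(s, k, l)` with `e = 2 k l s`; as `e` is nonzero, `k`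
  -- is nonzero and smaller.
  no-coprime-solution : ∀ e → NoCoprimeSolution e
  no-coprime-solution = <-rec NoCoprimeSolution step
    where
    step : ∀ e → (∀ {k} → k < e → NoCoprimeSolution k) → NoCoprimeSolution e
    step e rec {{e≢0}} n m co eq with descent₁ {n} {e} {m} co eq
    ... | r , s , eq₁ , sr-coprime , s-odd , refl with descent₂ {s} {r} {m} sr-coprime s-odd eq₁
    ...   | k , l , eq₂ , lk-coprime , refl = rec k<e s l lk-coprime eq₂
      where
      instance
        kls≢0 : NonZero (k * l * s)
        kls≢0 = m*n≢0⇒m≢0 (k * l * s)
        kl≢0 : NonZero (k * l)
        kl≢0 = m*n≢0⇒m≢0 (k * l) {s}
        k≢0 : NonZero k
        k≢0 = m*n≢0⇒m≢0 k {l}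
        l≢0 : NonZero l
        l≢0 = m*n≢0⇒n≢0 k {l}
        s≢0 : NonZero s
        s≢0 = m*n≢0⇒n≢0 (k * l) {s}

      k<e : k < k * l * s * 2
      k<e = begin-strict
        k              ≤⟨ m≤m*n k l ⟩
        k * l          ≤⟨ m≤m*n (k * l) s ⟩
        k * l * s      <⟨ m<m*n (k * l * s) 2 (n<1+n 1) ⟩
        k * l * s * 2  ∎
        where open ≤-Reasoning

  -- If `g` is the gcd of `e` and `m`, then `g⁴` divides `n²`, so `g²` divides `n` and the equation
  -- can be divided by `g⁴`.
  no-solution : ∀ e .{{_ : NonZero e}} n m → n ^ 2 + D * e ^ 4 ≢ m ^ 4
  no-solution e n m eq with gcd-factors e m
  ... | g , g≢0 , e′ , m′ , refl , refl , co with m²∣n²⇒m∣n {g ^ 2} {n} g⁴∣n²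
    where
    g⁴∣n² : (g ^ 2) ^ 2 ∣ n ^ 2
    g⁴∣n² = ∣m+n∣m⇒∣n
      (divides (m′ ^ 4) (trans (+-comm (D * (g * e′) ^ 4) (n ^ 2)) (trans eq
        (solve 2 (λ g m → (g :* m) :^ 4 := m :^ 4 :* (g :^ 2) :^ 2) refl g m′))))
      (divides (D * e′ ^ 4)
        (solve 3 (λ D g e → D :* (g :* e) :^ 4 := D :* e :^ 4 :* (g :^ 2) :^ 2) refl D g e′))
  ... | divides n′ refl = no-coprime-solution e′ {{m*n≢0⇒n≢0 g {e′}}} n′ m′ (Coprimality.sym co)
    (*-cancelˡ-≡ _ _ (g ^ 4) {{m^n≢0 g 4 {{g≢0}}}} (begin
      g ^ 4 * (n′ ^ 2 + D * e′ ^ 4)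
        ≡⟨ solve 4 (λ D g n e → g :^ 4 :* (n :^ 2 :+ D :* e :^ 4)
                             := (n :* g :^ 2) :^ 2 :+ D :* (g :* e) :^ 4) refl D g n′ e′ ⟩
      (n′ * g ^ 2) ^ 2 + D * (g * e′) ^ 4
        ≡⟨ eq ⟩
      (g * m′) ^ 4
        ≡⟨ solve 2 (λ g m → (g :* m) :^ 4 := g :^ 4 :* m :^ 4) refl g m′ ⟩
      g ^ 4 * m′ ^ 4 ∎))
    where open ≡-Reasoning

-- From rational points to the quartic

square-abs : ∀ i → i ℤ.* i ≡ + (∣ i ∣ ^ 2)
square-abs i = trans (lemma i) (cong +_ (cong (∣ i ∣ *_) (sym (*-identityʳ ∣ i ∣))))
  where
  lemma : ∀ i → i ℤ.* i ≡ + (∣ i ∣ * ∣ i ∣)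
  lemma (+ n)    = sym (ℤ.pos-* n n)
  lemma -[1+ n ] = refl

fourth-abs : ∀ i → i ℤ.* i ℤ.* (i ℤ.* i) ≡ + (∣ i ∣ ^ 4)
fourth-abs i = begin
  i ℤ.* i ℤ.* (i ℤ.* i)               ≡⟨ cong₂ ℤ._*_ (square-abs i) (square-abs i) ⟩
  + (∣ i ∣ ^ 2) ℤ.* + (∣ i ∣ ^ 2)     ≡⟨ ℤ.pos-* (∣ i ∣ ^ 2) (∣ i ∣ ^ 2) ⟨
  + (∣ i ∣ ^ 2 * ∣ i ∣ ^ 2)           ≡⟨ cong +_ (^-distribˡ-+-* ∣ i ∣ 2 2) ⟨
  + (∣ i ∣ ^ 4)                       ∎
  where open ≡-Reasoning

module _ (D : ℕ) where

  -- The factor used is `B⁴ C²` and not `B³ C²`, so that the left side is the square of `Y B²`.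
  clear-denominators : ∀ x y → y ℚ.* y ≡ x ℚ.* x ℚ.* x ℚ.+ (ℚ.- (+ D ℚ./ 1)) ℚ.* x ℚ.+ 0ℚ →
    let X = ℚ.↥ x; B = ℚ.↧ x; Y = ℚ.↥ y; C = ℚ.↧ y in
    Y ℤ.* Y ℤ.* (B ℤ.* B ℤ.* (B ℤ.* B)) ≡
    (X ℤ.* X ℤ.* X ℤ.* B ℤ.- + D ℤ.* X ℤ.* (B ℤ.* B ℤ.* B)) ℤ.* (C ℤ.* C)
  clear-denominators x@(mkℚ X b _) y@(mkℚ Y c _) eq = begin
    Y ℤ.* Y ℤ.* (B ℤ.* B ℤ.* (B ℤ.* B))
      ≡⟨ ℤ-solve 2 (λ Y B → Y ⊗ Y ⊗ (B ⊗ B ⊗ (B ⊗ B)) ⊜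
           Y ⊗ Y ⊗ (B ⊗ B ⊗ B ⊗ (⟨ + 1 ⟩ ⊗ B) ⊗ ⟨ + 1 ⟩)) refl Y B ⟩
    Y ℤ.* Y ℤ.* (B ℤ.* B ℤ.* B ℤ.* (+ 1 ℤ.* B) ℤ.* + 1)
      ≡⟨ ℚᵘ.drop-*≡* unnormalised ⟩
    ((X ℤ.* X ℤ.* X ℤ.* (+ 1 ℤ.* B) ℤ.+ (ℤ.- + D) ℤ.* X ℤ.* (B ℤ.* B ℤ.* B)) ℤ.* + 1 ℤ.+
      + 0 ℤ.* (B ℤ.* B ℤ.* B ℤ.* (+ 1 ℤ.* B))) ℤ.* (C ℤ.* C)
      ≡⟨ ℤ-solve 4 (λ X B C D →
           ((X ⊗ X ⊗ X ⊗ (⟨ + 1 ⟩ ⊗ B) ⊕ (⊝ D) ⊗ X ⊗ (B ⊗ B ⊗ B)) ⊗ ⟨ + 1 ⟩ ⊕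
             ⟨ + 0 ⟩ ⊗ (B ⊗ B ⊗ B ⊗ (⟨ + 1 ⟩ ⊗ B))) ⊗ (C ⊗ C) ⊜
           (X ⊗ X ⊗ X ⊗ B ⊖ D ⊗ X ⊗ (B ⊗ B ⊗ B)) ⊗ (C ⊗ C)) refl X B C (+ D) ⟩
    (X ℤ.* X ℤ.* X ℤ.* B ℤ.- + D ℤ.* X ℤ.* (B ℤ.* B ℤ.* B)) ℤ.* (C ℤ.* C) ∎
    where
    open ≡-Reasoning
    B = + suc b
    C = + suc c
    x′ = mkℚᵘ X b
    y′ = mkℚᵘ Y c
    D′ = mkℚᵘ (+ D) 0
    -- Normalisation hides numerators and denominators, so the equation is carried over to
    -- unnormalised fractions, whose operations compute.
    unnormalised : y′ ℚᵘ.* y′ ℚᵘ.≃ x′ ℚᵘ.* x′ ℚᵘ.* x′ ℚᵘ.+ (ℚᵘ.- D′) ℚᵘ.* x′ ℚᵘ.+ ℚᵘ.0ℚᵘ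
    unnormalised = ℚᵘ.≃-trans (ℚᵘ.≃-sym (ℚ.toℚᵘ-homo-* y y)) (ℚᵘ.≃-trans (ℚ.toℚᵘ-cong eq)
      (ℚᵘ.≃-trans (ℚ.toℚᵘ-homo-+ (x ℚ.* x ℚ.* x ℚ.+ -D ℚ.* x) 0ℚ) (ℚᵘ.+-cong
        (ℚᵘ.≃-trans (ℚ.toℚᵘ-homo-+ (x ℚ.* x ℚ.* x) (-D ℚ.* x)) (ℚᵘ.+-cong
          (ℚᵘ.≃-trans (ℚ.toℚᵘ-homo-* (x ℚ.* x) x) (ℚᵘ.*-cong (ℚ.toℚᵘ-homo-* x x) (ℚᵘ.≃-refl {x′})))
          (ℚᵘ.≃-trans (ℚ.toℚᵘ-homo-* -D x) (ℚᵘ.*-cong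
            (ℚᵘ.≃-trans (ℚ.toℚᵘ-homo‿- (+ D ℚ./ 1)) (ℚᵘ.-‿cong (ℚ.toℚᵘ-fromℚᵘ D′)))
            (ℚᵘ.≃-refl {x′})))))
        (ℚᵘ.≃-refl {ℚᵘ.0ℚᵘ}))))
      where -D = ℚ.- (+ D ℚ./ 1)

  -- The x-coordinate of 2(x, y) is w² with w = (x² + D) / 2y, and
  -- w⁴ - D = ((x⁴ - 6Dx² + D²) / 4y²)².
  duplication : ∀ x y → y ≢ 0ℚ → y ℚ.* y ≡ x ℚ.* x ℚ.* x ℚ.+ (ℚ.- (+ D ℚ./ 1)) ℚ.* x ℚ.+ 0ℚ →
    ∃ λ e → NonZero e × ∃₂ λ n m → n ^ 2 + D * e ^ 4 ≡ m ^ 4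
  duplication x@(mkℚ X b _) y@(mkℚ Y c _) y≢0 eq =
    ∣ E ∣ , E≢0 , ∣ N ∣ , ∣ M ∣ , ℤ.+-injective (begin
      + (∣ N ∣ ^ 2 + D * ∣ E ∣ ^ 4)
        ≡⟨ cong (λ t → + (∣ N ∣ ^ 2) ℤ.+ t) (ℤ.pos-* D (∣ E ∣ ^ 4)) ⟩
      + (∣ N ∣ ^ 2) ℤ.+ + D ℤ.* + (∣ E ∣ ^ 4)
        ≡⟨ cong₂ (λ s t → s ℤ.+ + D ℤ.* t) (square-abs N) (fourth-abs E) ⟨
      N ℤ.* N ℤ.+ + D ℤ.* (E ℤ.* E ℤ.* (E ℤ.* E))
        -- `E⁴ = 16 S²`, and the curve equation turns `S` into `T`. What remains is `(x⁴ - 6Dx² +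
        -- D²)² + 16D(x³ - Dx)² = (x² + D)⁴`, homogenised.
        ≡⟨ ℤ-solve 5 (λ X B Y C D →
             let N = (X ⊗ X ⊗ (X ⊗ X) ⊖ ⟨ + 6 ⟩ ⊗ D ⊗ (X ⊗ X) ⊗ (B ⊗ B) ⊕
                      D ⊗ D ⊗ (B ⊗ B ⊗ (B ⊗ B))) ⊗ (C ⊗ C)
                 E = ⟨ + 2 ⟩ ⊗ Y ⊗ (B ⊗ B)
                 S = Y ⊗ Y ⊗ (B ⊗ B ⊗ (B ⊗ B))
             in N ⊗ N ⊕ D ⊗ (E ⊗ E ⊗ (E ⊗ E)) ⊜ N ⊗ N ⊕ ⟨ + 16 ⟩ ⊗ D ⊗ (S ⊗ S)) refl X B Y C (+ D) ⟩
      N ℤ.* N ℤ.+ + 16 ℤ.* + D ℤ.* (S ℤ.* S)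
        ≡⟨ cong (λ s → N ℤ.* N ℤ.+ + 16 ℤ.* + D ℤ.* (s ℤ.* s)) (clear-denominators x y eq) ⟩
      N ℤ.* N ℤ.+ + 16 ℤ.* + D ℤ.* (T ℤ.* T)
        ≡⟨ ℤ-solve 4 (λ X B C D →
             let N = (X ⊗ X ⊗ (X ⊗ X) ⊖ ⟨ + 6 ⟩ ⊗ D ⊗ (X ⊗ X) ⊗ (B ⊗ B) ⊕
                      D ⊗ D ⊗ (B ⊗ B ⊗ (B ⊗ B))) ⊗ (C ⊗ C)
                 M = (X ⊗ X ⊕ D ⊗ (B ⊗ B)) ⊗ C
                 T = (X ⊗ X ⊗ X ⊗ B ⊖ D ⊗ X ⊗ (B ⊗ B ⊗ B)) ⊗ (C ⊗ C)
             in N ⊗ N ⊕ ⟨ + 16 ⟩ ⊗ D ⊗ (T ⊗ T) ⊜ M ⊗ M ⊗ (M ⊗ M)) refl X B C (+ D) ⟩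
      M ℤ.* M ℤ.* (M ℤ.* M)
        ≡⟨ fourth-abs M ⟩
      + (∣ M ∣ ^ 4) ∎)
    where
    open ≡-Reasoning
    B = + suc b
    C = + suc c
    -- Cleared of denominators, `M / E` is `w`, and `N / E²` is the square root of `w⁴ - D`.
    N = (X ℤ.* X ℤ.* (X ℤ.* X) ℤ.- + 6 ℤ.* + D ℤ.* (X ℤ.* X) ℤ.* (B ℤ.* B) ℤ.+
         + D ℤ.* + D ℤ.* (B ℤ.* B ℤ.* (B ℤ.* B))) ℤ.* (C ℤ.* C)
    E = + 2 ℤ.* Y ℤ.* (B ℤ.* B)
    M = (X ℤ.* X ℤ.+ + D ℤ.* (B ℤ.* B)) ℤ.* C
    S = Y ℤ.* Y ℤ.* (B ℤ.* B ℤ.* (B ℤ.* B))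
    T = (X ℤ.* X ℤ.* X ℤ.* B ℤ.- + D ℤ.* X ℤ.* (B ℤ.* B ℤ.* B)) ℤ.* (C ℤ.* C)

    E≢0 : NonZero ∣ E ∣
    E≢0 = ℤ.i*j≢0 (+ 2 ℤ.* Y) (B ℤ.* B) {{ℤ.i*j≢0 (+ 2) Y {{_}} {{Y≢0}}}}
      where Y≢0 = ℤ.≢-nonZero (y≢0 ∘ ℚ.↥p≡0⇒p≡0 y)

-- Torsion points and the rank

module _ (E : EllipticCurve) where

  two-torsion : ∀ x y .p → y ≡ ℚ.- y → _⊞_ E (affine x y p) (affine x y p) ≡ O
  two-torsion x y p y≡-y with x ℚ.≟ x | y ℚ.≟ ℚ.- y
  ... | yes _  | yes _    = refl
  ... | yes _  | no y≢-y  = contradiction y≡-y y≢-y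
  ... | no x≢x | _        = contradiction refl x≢x

theorem1p1 : (p q : ℕ) (pp : Prime p) (qp : Prime q) → p ≢ q →
    p % 40 ≡ 33 → q % 40 ≡ 7 →
    HasRank (pointGroup (curve p q pp qp)) 0
theorem1p1 p q pp qp p≢q p≡33 q≡7 = record
  -- `ℤ^ 0` is trivial, so the map is essentially the identity; its image is the required one
  -- because every point is torsion.
  { to = λ P → (λ ()) , P
  ; isGroupMonomorphism = record
    { isGroupHomomorphism = record
      { isMonoidHomomorphism = record
        { isMagmaHomomorphism = record
          { isRelHomomorphism = record { cong = λ { refl → (λ ()) , refl } }
          ; homo = λ _ _ → (λ ()) , refl
          }
        ; ε-homo = (λ ()) , refl
        }
      ; ⁻¹-homo = λ _ → (λ ()) , refl
      }
    ; injective = proj₂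
    }
  ; image = λ v P → mk⇔ (λ _ → P , (λ ()) , refl) (λ _ → torsion P)
  }
  where
  open Descent p q pp qp p≢q p≡33 q≡7

  E : EllipticCurve
  E = curve p q pp qp

  torsion : ∀ P → IsTorsion (pointGroup E) P
  torsion O = 1 , z<s , refl
  torsion (affine x y on) with y ℚ.≟ 0ℚ
  -- The double of `P` unfolds to `P ⊞ (P ⊞ O)`, which reduces to `P ⊞ P`.
  ... | yes refl = 2 , z<s , two-torsion E x 0ℚ on refl
  ... | no  y≢0 with duplication D x y y≢0 (onCurve-recompute E x y on)
  ...   | e , e≢0 , n , m , eq = contradiction eq (no-solution e {{e≢0}} n m)
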